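{- For all coherent graphs $G$ and $H$ with $V(G)\cap V(H)=\emptyset$, \[\{G\}^\perp\mathbin{\mathrm{par}}\{H\}^\perp=\{G\otimes H\}^\perp\qquad\text{and}\qquad \{G\}^\perp\otimes\{H\}^\perp=\{G\mathbin{\mathrm{par}} H\}^\perp,\] where $G\mathbin{\mathrm{par}} H$ is the coherent graph with vertex set $V(G)\sqcup V(H)$ whose edges are the edges of $G$, the edges of $H$ and, for each $u\in V(G)$ and $v\in V(H)$, two additional edges, $(u,v)$ from $u$ to $v$ and $(v,u)$ from $v$ to $u$; the coherence relation of $G\mathbin{\mathrm{par}} H$ restricts to that of $G$ on $E(G)$ and to that of $H$ on $E(H)$, every edge of $G$ is incoherent with every edge of $H$, and each additional edge is incoherent with all other edges.
   Context: Graphs are directed multigraphs: a vertex set $V(G)$, an edge set $E(G)$, and source and target maps $s,t:E(G)\to V(G)$ (parallel edges and loops are allowed). A coherence relation is a symmetric reflexive binary relation. A coherent graph is a graph $G$ with a coherence relation on $E(G)$; two edges are incoherent if they are not coherent. Plugging: $G \mathbin{\square} H$ has vertex set $V(G)\cup V(H)$ and edge set $E(G)+E(H)$ (disjoint union, remembering the provenance of edges). Its coherence relation restricts to those of $G$ and $H$, and every edge of $G$ is coherent with every edge of $H$. A cycle is a sequence $v_0,e_1,v_1,\dots,e_n,v_n$ with $n\ge 1$, $s(e_i)=v_{i-1}$, $t(e_i)=v_i$, $v_n=v_0$. A cycle in $G\mathbin{\square}H$ is alternating if, of any two consecutive edges (the last and the first edge also count as consecutive), exactly one is in $E(G)$.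 It is coherent if its edges are pairwise coherent. If $V(G)\cap V(H)=\emptyset$, $G\otimes H$ is the coherent graph with vertex set $V(G)\sqcup V(H)$ and edge set $E(G)\sqcup E(H)$, whose coherence restricts to those of $G$ and $H$ and where every edge of $G$ is coherent with every edge of $H$. Orthogonality: if $V(G)=V(H)$, then $G\perp H$ means that $G\mathbin{\square}H$ contains no coherent alternating cycle. For a set $X$ of coherent graphs on a common vertex set $V$, $X^\perp=\{G : V(G)=V,\ \forall H\in X,\ G\perp H\}$. A conduct $\mathbf{A}$ on $V(\mathbf{A})$ is a set of coherent graphs with vertex set $V(\mathbf{A})$ such that $\mathbf{A}=\mathbf{A}^{\perp\perp}$. For conducts on disjoint vertex sets: $\mathbf{A}\otimes\mathbf{B}=\{G\otimes H : G\in\mathbf{A},H\in\mathbf{B}\}^{\perp\perp}$ and $\mathbf{A}\mathbin{\mathrm{par}}\mathbf{B}=(\mathbf{A}^\perp\otimes\mathbf{B}^\perp)^\perp=\{G\otimes H : G\in\mathbf{A}^\perp,H\in\mathbf{B}^\perp\}^{\perp}$. -}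

module Defs where

open import Data.List.Base using (List; []; _∷_; _∷ʳ_; map)
open import Data.List.Membership.Propositional using (_∈_)
open import Data.List.Membership.Propositional.Properties using (∈-map⁻)
open import Data.List.Properties using (map-++)
import Data.List.Relation.Unary.Linked as Linked
import Data.List.Relation.Unary.Linked.Properties as Linkedₚ
open Linked using (Linked)
open import Data.Product.Base using (Σ; _×_; _,_)
open import Data.Sum.Base using (_⊎_; inj₁; inj₂; [_,_]′; swap)
import Data.Sum.Base as Sum
open import Level using (Level; suc; _⊔_)
open import Relation.Binary.Core using (Rel)
open import Relation.Binary.Definitions using (Reflexive; Symmetric)
open import Relation.Binary.PropositionalEquality using (_≡_; refl; trans; subst)
open import Relation.Nullary.Negation using (¬_)
open import Relation.Unary using (Pred; _⊆_; _≐_) renaming (_∈_ to _∈ₚ_)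

private
  variable
    ℓ : Level
    V W : Set ℓ

-- Vertices, edges and coherence proofs live in one universe, so that this
-- universe also contains edge sets built from vertices or from coherent walks.
record CoherentGraph {ℓ : Level} (V : Set ℓ) : Set (suc ℓ) where
  field
    Edge         : Set ℓ
    source       : Edge → V
    target       : Edge → V
    Coh          : Rel Edge ℓ
    Coh-refl     : Reflexive Coh
    Coh-sym      : Symmetric Coh

open CoherentGraph

-- Coherence on a disjoint union of edge sets: the given relations on each
-- side, and everything coherent across the two sides.
data SumCoh {ℓ : Level} {E F : Set ℓ} (R : Rel E ℓ) (S : Rel F ℓ) : Rel (E ⊎ F) ℓ where
  left   : ∀ {e e′} → R e e′ → SumCoh R S (inj₁ e) (inj₁ e′)
  right  : ∀ {f f′} → S f f′ → SumCoh R S (inj₂ f) (inj₂ f′)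
  cross  : ∀ {e f} → SumCoh R S (inj₁ e) (inj₂ f)
  cross′ : ∀ {e f} → SumCoh R S (inj₂ f) (inj₁ e)

SumCoh-refl : {E F : Set ℓ} {R : Rel E ℓ} {S : Rel F ℓ} →
              Reflexive R → Reflexive S → Reflexive (SumCoh R S)
SumCoh-refl r s {inj₁ _} = left r
SumCoh-refl r s {inj₂ _} = right s

SumCoh-sym : {E F : Set ℓ} {R : Rel E ℓ} {S : Rel F ℓ} →
             Symmetric R → Symmetric S → Symmetric (SumCoh R S)
SumCoh-sym r s (left p)  = left (r p)
SumCoh-sym r s (right p) = right (s p)
SumCoh-sym r s cross     = cross′
SumCoh-sym r s cross′    = cross

infixr 6 _□_ _⊗_

-- Plugging of two graphs on the same vertex set, the case which
-- orthogonality uses.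
_□_ : CoherentGraph V → CoherentGraph V → CoherentGraph V
G □ H = record
  { Edge     = Edge G ⊎ Edge H
  ; source   = [ source G , source H ]′
  ; target   = [ target G , target H ]′
  ; Coh      = SumCoh (Coh G) (Coh H)
  ; Coh-refl = SumCoh-refl (Coh-refl G) (Coh-refl H)
  ; Coh-sym  = SumCoh-sym (Coh-sym G) (Coh-sym H)
  }

-- Disjointness of the vertex sets is built in: the vertex set of the result
-- is the disjoint sum V ⊎ W.
_⊗_ : {V W : Set ℓ} → CoherentGraph V → CoherentGraph W → CoherentGraph (V ⊎ W)
G ⊗ H = record
  { Edge     = Edge G ⊎ Edge H
  ; source   = Sum.map (source G) (source H)
  ; target   = Sum.map (target G) (target H)
  ; Coh      = SumCoh (Coh G) (Coh H)
  ; Coh-refl = SumCoh-refl (Coh-refl G) (Coh-refl H)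
  ; Coh-sym  = SumCoh-sym (Coh-sym G) (Coh-sym H)
  }

module _ {V W : Set ℓ} (G : CoherentGraph V) (H : CoherentGraph W) where

  data ⅋-Edge : Set ℓ where
    left  : Edge G → ⅋-Edge
    right : Edge H → ⅋-Edge
    there : V → W → ⅋-Edge
    back  : W → V → ⅋-Edge

  ⅋-source : ⅋-Edge → V ⊎ W
  ⅋-source (left e)    = inj₁ (source G e)
  ⅋-source (right f)   = inj₂ (source H f)
  ⅋-source (there u v) = inj₁ u
  ⅋-source (back v u)  = inj₂ v

  ⅋-target : ⅋-Edge → V ⊎ W
  ⅋-target (left e)    = inj₁ (target G e)
  ⅋-target (right f)   = inj₂ (target H f)
  ⅋-target (there u v) = inj₂ v
  ⅋-target (back v u)  = inj₁ u

  -- An additional edge is coherent with itself only.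
  data ⅋-Coh : Rel ⅋-Edge ℓ where
    left  : ∀ {e e′} → Coh G e e′ → ⅋-Coh (left e) (left e′)
    right : ∀ {f f′} → Coh H f f′ → ⅋-Coh (right f) (right f′)
    there : ∀ {u v} → ⅋-Coh (there u v) (there u v)
    back  : ∀ {u v} → ⅋-Coh (back v u) (back v u)

  ⅋-Coh-refl : Reflexive ⅋-Coh
  ⅋-Coh-refl {left _}    = left (Coh-refl G)
  ⅋-Coh-refl {right _}   = right (Coh-refl H)
  ⅋-Coh-refl {there _ _} = there
  ⅋-Coh-refl {back _ _}  = back

  ⅋-Coh-sym : Symmetric ⅋-Coh
  ⅋-Coh-sym (left p)  = left (Coh-sym G p)
  ⅋-Coh-sym (right p) = right (Coh-sym H p)
  ⅋-Coh-sym there     = there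
  ⅋-Coh-sym back      = back

  infixr 6 _⅋_

  _⅋_ : CoherentGraph (V ⊎ W)
  _⅋_ = record
    { Edge     = ⅋-Edge
    ; source   = ⅋-source
    ; target   = ⅋-target
    ; Coh      = ⅋-Coh
    ; Coh-refl = ⅋-Coh-refl
    ; Coh-sym  = ⅋-Coh-sym
    }

-- Walk G u es w: the sequence es of edges of G leads from u to w.
data Walk {ℓ : Level} {V : Set ℓ} (G : CoherentGraph V) : V → List (Edge G) → V → Set ℓ where
  []   : ∀ {u} → Walk G u [] u
  step : ∀ {u v w es} (e : Edge G) → source G e ≡ u → target G e ≡ v →
         Walk G v es w → Walk G u (e ∷ es) w

record Cycle {ℓ : Level} {V : Set ℓ} (G : CoherentGraph V) : Set ℓ where
  field
    base  : V
    first : Edge G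
    rest  : List (Edge G)
    walk  : Walk G base (first ∷ rest) base

  edges : List (Edge G)
  edges = first ∷ rest

  -- Repeating the first edge at the end makes the last and the first edge
  -- consecutive, so that a cycle of length 1 has its edge consecutive to itself.
  Consecutively : {a : Level} → Rel (Edge G) a → Set (ℓ ⊔ a)
  Consecutively R = Linked R (edges ∷ʳ first)

open Cycle

Coherent : {G : CoherentGraph V} → Cycle G → Set _
Coherent {G = G} c = ∀ {e f} → e ∈ edges c → f ∈ edges c → Coh G e f

IsLeft : {E F : Set ℓ} → E ⊎ F → Set ℓ
IsLeft {E = E} x = Σ E λ e → x ≡ inj₁ e

ExactlyOneLeft : {E F : Set ℓ} → Rel (E ⊎ F) ℓ
ExactlyOneLeft x y = (IsLeft x × ¬ IsLeft y) ⊎ (¬ IsLeft x × IsLeft y)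

Alternating : (G H : CoherentGraph V) → Cycle (G □ H) → Set _
Alternating G H c = Consecutively c ExactlyOneLeft

infix 4 _⟂_

_⟂_ : CoherentGraph V → CoherentGraph V → Set _
G ⟂ H = ¬ (Σ (Cycle (G □ H)) λ c → Coherent c × Alternating G H c)

GraphSet : {ℓ : Level} → Set ℓ → Set (suc (suc ℓ))
GraphSet {ℓ} V = Pred (CoherentGraph V) (suc ℓ)

infix 10 _^⊥

_^⊥ : {V : Set ℓ} → GraphSet V → GraphSet V
(X ^⊥) G = ∀ H → H ∈ₚ X → G ⟂ H

record Conduct {ℓ : Level} (V : Set ℓ) : Set (suc (suc ℓ)) where
  field
    members : GraphSet V
    closed  : members ≐ members ^⊥ ^⊥

open Conduct public using (members)

⟂-sym : {G H : CoherentGraph V} → G ⟂ H → H ⟂ G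
⟂-sym {G = G} {H} G⟂H (c , coh , alt) = G⟂H (c′ , coh′ , alt′)
  where
  src : ∀ e → source (G □ H) (swap e) ≡ source (H □ G) e
  src (inj₁ _) = refl
  src (inj₂ _) = refl

  tgt : ∀ e → target (G □ H) (swap e) ≡ target (H □ G) e
  tgt (inj₁ _) = refl
  tgt (inj₂ _) = refl

  swapWalk : ∀ {u es w} → Walk (H □ G) u es w → Walk (G □ H) u (map swap es) w
  swapWalk []             = []
  swapWalk (step e p q r) =
    step (swap e) (trans (src e) p) (trans (tgt e) q) (swapWalk r)

  c′ : Cycle (G □ H)
  c′ = record { walk = swapWalk (walk c) }

  swapCoh : ∀ {e f} → Coh (H □ G) e f → Coh (G □ H) (swap e) (swap f)
  swapCoh (left p)  = right p
  swapCoh (right p) = left p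
  swapCoh cross     = cross′
  swapCoh cross′    = cross

  coh′ : Coherent c′
  coh′ e∈ f∈ with ∈-map⁻ swap e∈ | ∈-map⁻ swap f∈
  ... | _ , e∈′ , refl | _ , f∈′ , refl = swapCoh (coh e∈′ f∈′)

  swapOne : {e f : Edge (H □ G)} → ExactlyOneLeft e f → ExactlyOneLeft (swap e) (swap f)
  swapOne {inj₁ _} {inj₂ _} _ = inj₂ ((λ ()) , _ , refl)
  swapOne {inj₂ _} {inj₁ _} _ = inj₁ ((_ , refl) , λ ())
  swapOne {inj₁ _} {inj₁ _} (inj₁ (_ , n)) with () ← n (_ , refl)
  swapOne {inj₁ _} {inj₁ _} (inj₂ (n , _)) with () ← n (_ , refl)
  swapOne {inj₂ _} {inj₂ _} (inj₁ ((_ , ()) , _))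
  swapOne {inj₂ _} {inj₂ _} (inj₂ (_ , _ , ()))

  alt′ : Alternating G H c′
  alt′ = subst (Linked ExactlyOneLeft) (map-++ swap (edges c) (first c ∷ []))
           (Linkedₚ.map⁺ (Linked.map swapOne alt))

^⊥-antitone : {V : Set ℓ} {X Y : GraphSet V} → X ⊆ Y → Y ^⊥ ⊆ X ^⊥
^⊥-antitone X⊆Y G∈Y⊥ H H∈X = G∈Y⊥ H (X⊆Y H∈X)

⊆-^⊥^⊥ : {V : Set ℓ} (X : GraphSet V) → X ⊆ X ^⊥ ^⊥
⊆-^⊥^⊥ X {G} G∈X H H∈X⊥ = ⟂-sym (H∈X⊥ G G∈X)

infix 10 _^⊥ᶜ

_^⊥ᶜ : {V : Set ℓ} → GraphSet V → Conduct V
X ^⊥ᶜ = record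
  { members = X ^⊥
  ; closed  = ⊆-^⊥^⊥ (X ^⊥) , ^⊥-antitone (⊆-^⊥^⊥ X)
  }

infixr 6 _⊗ᶜ_ _⅋ᶜ_

data Tensors {ℓ : Level} {V W : Set ℓ} (X : GraphSet V) (Y : GraphSet W) :
             GraphSet (V ⊎ W) where
  tensor : ∀ {G H} → G ∈ₚ X → H ∈ₚ Y → Tensors X Y (G ⊗ H)

_⊗ᶜ_ : {V W : Set ℓ} → Conduct V → Conduct W → Conduct (V ⊎ W)
A ⊗ᶜ B = (Tensors (members A) (members B) ^⊥) ^⊥ᶜ

_⅋ᶜ_ : {V W : Set ℓ} → Conduct V → Conduct W → Conduct (V ⊎ W)
A ⅋ᶜ B = members (members A ^⊥ᶜ ⊗ᶜ members B ^⊥ᶜ) ^⊥ᶜ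

infix 4 _≐ᶜ_

_≐ᶜ_ : {V : Set ℓ} → Conduct V → Conduct V → Set (suc ℓ)
A ≐ᶜ B = members A ≐ members B

{-# OPTIONS --safe #-}
-- First equation: orthogonality of K to G ⊗ H can be tested one component at a
-- time. Let exec K H be the graph on V whose edges are the coherent alternating
-- paths of K and H between vertices of V. The coherent alternating cycles of K
-- and G ⊗ H that use an edge of G correspond to those of exec K H and G, and the
-- others do not depend on G. Hence G may be replaced by any member of {G}^⊥⊥, and
-- then H by any member of {H}^⊥⊥.
--
-- Second equation: if K ⟂ G ⅋ H, then K has no edge between V and W (it would
-- form a cycle with an additional edge of G ⅋ H), so K is, up to having fewer
-- coherent pairs, the tensor of its restrictions to V and W, which are orthogonal
-- to G and H. Conversely, the edges of G ⅋ H in a coherent cycle all come from G,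
-- or all from H, or are all the same additional edge.
module Submission where

open import Defs
open import Data.Empty using (⊥)
open import Data.List.Base using (List; []; _∷_; _∷ʳ_; _++_; map)
open import Data.List.Membership.Propositional using (_∈_; find)
open import Data.List.Membership.Propositional.Properties using (∈-map⁻; ∈-∃++)
open import Data.List.Relation.Binary.Permutation.Propositional.Properties
  using (∈-resp-↭; ++-comm)
open import Data.List.Relation.Unary.All as All using (All; []; _∷_)
open import Data.List.Relation.Unary.All.Properties using (++⁺)
open import Data.List.Relation.Unary.Any using (Any; here; there)
open import Data.List.Relation.Unary.Linked using (Linked; [-]; _∷_)
open import Data.Product.Base using (Σ; ∃; ∃₂; _×_; _,_)
open import Data.Sum.Base using (_⊎_; inj₁; inj₂; swap)
open import Data.Sum.Properties using (inj₁-injective; inj₂-injective; swap-involutive)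
open import Data.Sum.Relation.Binary.Pointwise using (Pointwise; inj₁; inj₂)
open import Function.Base using (_∘_; id)
open import Level using (Level; suc; _⊔_)
open import Relation.Binary.Core using (Rel)
open import Relation.Binary.PropositionalEquality
  using (_≡_; refl; sym; trans; cong)
open import Relation.Nullary.Negation using (¬_; contradiction)
open import Relation.Unary using (Pred; ｛_｝) renaming (_∈_ to _∈ₚ_)

open CoherentGraph

private
  variable
    ℓ : Level
    V : Set ℓ

-- Coherent alternating cycles as closed chains

infixr 5 _∷_

-- The end `z` stays out of the list, so a closed chain from `x` to `x` lists each position of the
-- cycle exactly once, in `x ∷ ys`.
data Chain {a r : Level} {A : Set a} (R : Rel A r) : A → List A → A → Set (a ⊔ r) where
  last : ∀ {x z} → R x z → Chain R x [] z
  _∷_  : ∀ {x y z ys} → R x y → Chain R y ys z → Chain R x (y ∷ ys) z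

module _ {a r : Level} {A : Set a} {R : Rel A r} where

  infixr 5 _++ᶜ_

  _++ᶜ_ : ∀ {x xs y ys z} → Chain R x xs y → Chain R y ys z → Chain R x (xs ++ y ∷ ys) z
  last r  ++ᶜ d = r ∷ d
  (r ∷ c) ++ᶜ d = r ∷ (c ++ᶜ d)

  split : ∀ {x z y ys} xs → Chain R x (xs ++ y ∷ ys) z → Chain R x xs y × Chain R y ys z
  split []       (r ∷ c) = last r , c
  split (_ ∷ xs) (r ∷ c) with split xs c
  ... | c₁ , c₂ = r ∷ c₁ , c₂

  -- The chain is cut at `y` and the two pieces are glued in the other order. The inclusion of edges
  -- is what carries pairwise coherence over.
  rotate : ∀ {x xs y} → Chain R x xs x → y ∈ x ∷ xs →
           ∃ λ ys → Chain R y ys y × (∀ {z} → z ∈ y ∷ ys → z ∈ x ∷ xs)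
  rotate c (here refl) = _ , c , id
  rotate {x} c (there y∈xs) with ∈-∃++ y∈xs
  ... | as , bs , refl with split as c
  ... | c₁ , c₂ = bs ++ x ∷ as , c₂ ++ᶜ c₁ , ∈-resp-↭ (++-comm (_ ∷ bs) (x ∷ as))

-- Incidence and alternation in one relation: two edges on the same side have no constructor, so
-- matching on a link also tells which graph comes next.
data Link {V : Set ℓ} (G H : CoherentGraph V) : Rel (Edge (G □ H)) ℓ where
  lr : ∀ {e f} → target G e ≡ source H f → Link G H (inj₁ e) (inj₂ f)
  rl : ∀ {e f} → target H f ≡ source G e → Link G H (inj₂ f) (inj₁ e)

-- A coherent alternating cycle, which may be read from any of its edges.
record Clash {V : Set ℓ} (G H : CoherentGraph V) : Set ℓ where
  field
    first    : Edge (G □ H)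
    rest     : List (Edge (G □ H))
    chain    : Chain (Link G H) first rest first
    coherent : ∀ {e f} → e ∈ first ∷ rest → f ∈ first ∷ rest → Coh (G □ H) e f

  edges : List (Edge (G □ H))
  edges = first ∷ rest

open Clash

rotate-to : {G H : CoherentGraph V} (c : Clash G H) {e : Edge (G □ H)} → e ∈ edges c →
            Σ (Clash G H) λ d → first d ≡ e
rotate-to c e∈c with rotate (chain c) e∈c
... | _ , d , d⊆c =
  record { chain = d ; coherent = λ e∈ f∈ → coherent c (d⊆c e∈) (d⊆c f∈) } , refl

module _ {V : Set ℓ} {G H : CoherentGraph V} where

  private
    link : ∀ {e f} → target (G □ H) e ≡ source (G □ H) f → ExactlyOneLeft e f → Link G H e f
    link {inj₁ _} {inj₁ _} _ (inj₁ (_ , ¬l)) = contradiction (_ , refl) ¬l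
    link {inj₁ _} {inj₁ _} _ (inj₂ (¬l , _)) = contradiction (_ , refl) ¬l
    link {inj₁ _} {inj₂ _} p _               = lr p
    link {inj₂ _} {inj₁ _} p _               = rl p
    link {inj₂ _} {inj₂ _} _ (inj₁ ((_ , ()) , _))
    link {inj₂ _} {inj₂ _} _ (inj₂ (_ , _ , ()))

    incident : ∀ {e f} → Link G H e f → target (G □ H) e ≡ source (G □ H) f
    incident (lr p) = p
    incident (rl p) = p

    exactlyOneLeft : ∀ {e f} → Link G H e f → ExactlyOneLeft e f
    exactlyOneLeft (lr _) = inj₁ ((_ , refl) , λ ())
    exactlyOneLeft (rl _) = inj₂ ((λ ()) , _ , refl)

    -- Here `f` is the first edge, repeated at the end, and the equation on `w` says that the walk
    -- returns to its source.
    toChain : ∀ {u w e es f} → Walk (G □ H) u (e ∷ es) w → w ≡ source (G □ H) f →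
              Linked ExactlyOneLeft (e ∷ es ∷ʳ f) → Chain (Link G H) e es f
    toChain (step _ _ q []) w≡ (o ∷ _) = last (link (trans q w≡) o)
    toChain (step _ _ q w@(step _ p _ _)) w≡ (o ∷ os) =
      link (trans q (sym p)) o ∷ toChain w w≡ os

    toWalk : ∀ {e es f} → Chain (Link G H) e es f →
             Walk (G □ H) (source (G □ H) e) (e ∷ es) (source (G □ H) f)
    toWalk (last l) = step _ refl (incident l) []
    toWalk (l ∷ c)  = step _ refl (incident l) (toWalk c)

    toLinked : ∀ {e es f} → Chain (Link G H) e es f → Linked ExactlyOneLeft (e ∷ es ∷ʳ f)
    toLinked (last l) = exactlyOneLeft l ∷ [-]
    toLinked (l ∷ c)  = exactlyOneLeft l ∷ toLinked c

    base≡source : ∀ {u e es w} → Walk (G □ H) u (e ∷ es) w → u ≡ source (G □ H) e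
    base≡source (step _ p _ _) = sym p

  ¬Clash⇒⟂ : ¬ Clash G H → G ⟂ H
  ¬Clash⇒⟂ ¬c (c , coh , alt) = ¬c record
    { chain    = toChain (Cycle.walk c) (base≡source (Cycle.walk c)) alt
    ; coherent = coh
    }

  ⟂⇒¬Clash : G ⟂ H → ¬ Clash G H
  ⟂⇒¬Clash G⟂H c =
    G⟂H (record { walk = toWalk (chain c) } , coherent c , toLinked (chain c))

-- Transport of cycles along relations between edges

-- Block e x xs: the edge e is replaced by the nonempty run of edges x ∷ xs.
module Refinement {U U′ : Set ℓ} {G H : CoherentGraph U} {G′ H′ : CoherentGraph U′}
  (Block : Edge (G □ H) → Edge (G′ □ H′) → List (Edge (G′ □ H′)) → Set ℓ)
  (block-chain : ∀ {e f x y xs ys} → Block e x xs → Block f y ys → Link G H e f →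
                 Chain (Link G′ H′) x xs y)
  (block-coh : ∀ {e f x y xs ys} → Block e x xs → Block f y ys → Coh (G □ H) e f →
               ∀ {x′ y′} → x′ ∈ x ∷ xs → y′ ∈ y ∷ ys → Coh (G′ □ H′) x′ y′)
  where

  -- Each `block-chain` runs up to the first edge of the next block, so the runs glue together
  -- around the cycle.
  refine : (c : Clash G H) → (∀ {e} → e ∈ edges c → ∃₂ (Block e)) → Clash G′ H′
  refine c total with total (here refl)
  -- The block of the first edge is chosen once and used at both ends, so that the new chain closes
  -- at `x`.
  ... | x , xs , b = assemble (go (chain c) first-block first-block (All.tabulate λ e∈ →
                       there e∈ , total (there e∈)))
    where
    InBlock : Edge (G □ H) → Set ℓ
    InBlock e = e ∈ edges c × ∃₂ (Block e)

    first-block : InBlock (first c)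
    first-block = here refl , x , xs , b

    -- Each new edge remembers an edge of `c` behind it; coherence of two new edges comes from that
    -- of their origins.
    FromBlock : Edge (G′ □ H′) → Set ℓ
    FromBlock z = ∃ λ e → e ∈ edges c × ∃₂ λ y ys → Block e y ys × z ∈ y ∷ ys

    all-from : ∀ {e y ys} → e ∈ edges c → Block e y ys → All FromBlock (y ∷ ys)
    all-from e∈ d = All.tabulate λ z∈ → _ , e∈ , _ , _ , d , z∈

    go : ∀ {e es f} → Chain (Link G H) e es f →
         ((_ , y , _) : InBlock e) ((_ , z , _) : InBlock f) → All InBlock es →
         ∃ λ zs → Chain (Link G′ H′) y zs z × All FromBlock (y ∷ zs)
    go (last l) (e∈ , _ , ys , d) (_ , _ , _ , d′) [] =
      ys , block-chain d d′ l , all-from e∈ d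
    go (l ∷ es) (e∈ , _ , ys , d) z (d′@(_ , _ , _ , d″) ∷ ds) with go es d′ z ds
    ... | _ , zs , from = _ , block-chain d d″ l ++ᶜ zs , ++⁺ (all-from e∈ d) from

    assemble : (∃ λ zs → Chain (Link G′ H′) x zs x × All FromBlock (x ∷ zs)) → Clash G′ H′
    assemble (zs , ch , from) = record { chain = ch ; coherent = coh }
      where
      coh : ∀ {e f} → e ∈ x ∷ zs → f ∈ x ∷ zs → Coh (G′ □ H′) e f
      coh e∈ f∈ with All.lookup from e∈ | All.lookup from f∈
      ... | _ , d∈ , _ , _ , d , e∈d | _ , d′∈ , _ , _ , d′ , f∈d′ =
        block-coh d d′ (coherent c d∈ d′∈) e∈d f∈d′

-- Vertices of the two graphs are matched by comparing them in X.
record PartialMorphism {U U′ X : Set ℓ} (j : U → X) (j′ : U′ → X)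
                       (G : CoherentGraph U) (G′ : CoherentGraph U′) : Set (suc ℓ) where
  infix 4 _~_
  field
    _~_      : Edge G → Edge G′ → Set ℓ
    ~-source : ∀ {e e′} → e ~ e′ → j (source G e) ≡ j′ (source G′ e′)
    ~-target : ∀ {e e′} → e ~ e′ → j (target G e) ≡ j′ (target G′ e′)
    ~-Coh    : ∀ {e e′ f f′} → e ~ e′ → f ~ f′ → Coh G e f → Coh G′ e′ f′

open PartialMorphism

module _ {U U′ X : Set ℓ} {j : U → X} {j′ : U′ → X} (j′-injective : ∀ {u v} → j′ u ≡ j′ v → u ≡ v)
         {G H : CoherentGraph U} {G′ H′ : CoherentGraph U′}
         (M : PartialMorphism j j′ G G′) (N : PartialMorphism j j′ H H′) where

  private
    Block : Edge (G □ H) → Edge (G′ □ H′) → List (Edge (G′ □ H′)) → Set ℓ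
    Block e x xs = Pointwise (_~_ M) (_~_ N) e x × xs ≡ []

    block-chain : ∀ {e f x y xs ys} → Block e x xs → Block f y ys → Link G H e f →
                  Chain (Link G′ H′) x xs y
    block-chain (inj₁ p , refl) (inj₂ q , _) (lr l) =
      last (lr (j′-injective (trans (sym (~-target M p)) (trans (cong j l) (~-source N q)))))
    block-chain (inj₂ p , refl) (inj₁ q , _) (rl l) =
      last (rl (j′-injective (trans (sym (~-target N p)) (trans (cong j l) (~-source M q)))))

    block-coh : ∀ {e f x y xs ys} → Block e x xs → Block f y ys → Coh (G □ H) e f →
                ∀ {x′ y′} → x′ ∈ x ∷ xs → y′ ∈ y ∷ ys → Coh (G′ □ H′) x′ y′
    block-coh (inj₁ p , refl) (inj₁ q , refl) (left c)  (here refl) (here refl) = left (~-Coh M p q c)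
    block-coh (inj₁ _ , refl) (inj₂ _ , refl) cross     (here refl) (here refl) = cross
    block-coh (inj₂ _ , refl) (inj₁ _ , refl) cross′    (here refl) (here refl) = cross′
    block-coh (inj₂ p , refl) (inj₂ q , refl) (right c) (here refl) (here refl) = right (~-Coh N p q c)

  -- Every block is a single related edge. Injectivity of `j′` turns equality in `X` back into
  -- incidence.
  transport : (c : Clash G H) →
              (∀ {e} → e ∈ edges c → ∃ (Pointwise (_~_ M) (_~_ N) e)) → Clash G′ H′
  transport c total = Refinement.refine Block block-chain block-coh c λ e∈ →
    let x , p = total e∈ in x , [] , p , refl

  transport-total : (∀ e → ∃ (_~_ M e)) → (∀ f → ∃ (_~_ N f)) → Clash G H → Clash G′ H′
  transport-total m n c = transport c λ {e} _ → total e
    where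
    total : ∀ e → ∃ (Pointwise (_~_ M) (_~_ N) e)
    total (inj₁ e) = let e′ , p = m e in inj₁ e′ , inj₁ p
    total (inj₂ f) = let f′ , p = n f in inj₂ f′ , inj₂ p

identity : {G : CoherentGraph V} → PartialMorphism id id G G
identity = record
  { _~_      = _≡_
  ; ~-source = cong _
  ; ~-target = cong _
  ; ~-Coh    = λ { refl refl c → c }
  }

-- Taken along `swap`, it reduces the right factor of a tensor to the left one.
reindex : {V W : Set ℓ} → (V → W) → CoherentGraph V → CoherentGraph W
reindex j G = record
  { Edge     = Edge G
  ; source   = j ∘ source G
  ; target   = j ∘ target G
  ; Coh      = Coh G
  ; Coh-refl = Coh-refl G
  ; Coh-sym  = Coh-sym G
  }

-- Execution of `K` against `H`

-- A path starts and ends with an edge of K, and its inner vertices lie in W.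
module Execution {V W : Set ℓ} (K : CoherentGraph (V ⊎ W)) (H : CoherentGraph W) where

  Step : Set ℓ
  Step = Edge K ⊎ Edge H

  -- The coherence of plugging `K` with `H`; `_□_` does not apply, as `H` lives on `W` only.
  _≍_ : Rel Step ℓ
  _≍_ = SumCoh (Coh K) (Coh H)

  data Path : Edge K → List Step → V → Set ℓ where
    stop : ∀ {k v} → target K k ≡ inj₁ v → Path k [] v
    pass : ∀ {k h k′ es v} → target K k ≡ inj₂ (source H h) → inj₂ (target H h) ≡ source K k′ →
           Path k′ es v → Path k (inj₂ h ∷ inj₁ k′ ∷ es) v

  record PathEdge : Set ℓ where
    constructor mkPathEdge
    field
      {from to} : V
      {entry}   : Edge K
      {steps}   : List Step
      source≡   : source K entry ≡ inj₁ from
      path      : Path entry steps to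
      coh       : ∀ {e f} → e ∈ inj₁ entry ∷ steps → f ∈ inj₁ entry ∷ steps → e ≍ f

    allSteps : List Step
    allSteps = inj₁ entry ∷ steps

  open PathEdge

  -- Coherence of two paths is what a coherent cycle through both demands of their edges.
  -- Reflexivity is then the coherence of a single path, which is why `PathEdge` has the field
  -- `coh`.
  exec : CoherentGraph V
  exec = record
    { Edge     = PathEdge
    ; source   = from
    ; target   = to
    ; Coh      = λ p q → ∀ {e f} → e ∈ allSteps p → f ∈ allSteps q → e ≍ f
    ; Coh-refl = λ {p} → coh p
    ; Coh-sym  = λ c e∈ f∈ → SumCoh-sym (Coh-sym K) (Coh-sym H) (c f∈ e∈)
    }

  module _ {G : CoherentGraph V} where

    private
      ι : Step → Edge (K □ (G ⊗ H))
      ι (inj₁ k) = inj₁ k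
      ι (inj₂ h) = inj₂ (inj₂ h)

      ι-coh : ∀ {e f} → e ≍ f → Coh (K □ (G ⊗ H)) (ι e) (ι f)
      ι-coh (left c)  = left c
      ι-coh (right c) = right (right c)
      ι-coh cross     = cross
      ι-coh cross′    = cross′

      ι-coh⁻ : ∀ {e f} → Coh (K □ (G ⊗ H)) (ι e) (ι f) → e ≍ f
      ι-coh⁻ {inj₁ _} {inj₁ _} (left c)          = left c
      ι-coh⁻ {inj₁ _} {inj₂ _} _                 = cross
      ι-coh⁻ {inj₂ _} {inj₁ _} _                 = cross′
      ι-coh⁻ {inj₂ _} {inj₂ _} (right (right c)) = right c

      ι-cross : ∀ {g} e → Coh (K □ (G ⊗ H)) (ι e) (inj₂ (inj₁ g))
      ι-cross (inj₁ _) = cross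
      ι-cross (inj₂ _) = right cross′

    module _ where
      private
        data Block : Edge (exec □ G) → Edge (K □ (G ⊗ H)) → List (Edge (K □ (G ⊗ H))) → Set ℓ where
          unfold : ∀ {p} → Block (inj₁ p) (inj₁ (entry p)) (map ι (steps p))
          keep   : ∀ {g} → Block (inj₂ g) (inj₂ (inj₁ g)) []

        path-chain : ∀ {k es v f} → Path k es v → inj₁ v ≡ source (G ⊗ H) f →
                     Chain (Link K (G ⊗ H)) (inj₁ k) (map ι es) (inj₂ f)
        path-chain (stop p)     q = last (lr (trans p q))
        path-chain (pass s t p) q = lr s ∷ rl t ∷ path-chain p q

        block-chain : ∀ {e f x y xs ys} → Block e x xs → Block f y ys → Link exec G e f →
                      Chain (Link K (G ⊗ H)) x xs y
        block-chain (unfold {p}) keep (lr l) = path-chain (path p) (cong inj₁ l)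
        block-chain keep (unfold {p}) (rl l) = last (rl (trans (cong inj₁ l) (sym (source≡ p))))

        block-coh : ∀ {e f x y xs ys} → Block e x xs → Block f y ys → Coh (exec □ G) e f →
                    ∀ {x′ y′} → x′ ∈ x ∷ xs → y′ ∈ y ∷ ys → Coh (K □ (G ⊗ H)) x′ y′
        block-coh (unfold {p}) (unfold {q}) (left c) x∈ y∈ with ∈-map⁻ ι x∈ | ∈-map⁻ ι y∈
        ... | _ , s∈ , refl | _ , t∈ , refl = ι-coh (c s∈ t∈)
        block-coh (unfold {p}) keep _ x∈ (here refl) with ∈-map⁻ ι x∈
        ... | s , _ , refl = ι-cross s
        block-coh keep (unfold {p}) _ (here refl) y∈ with ∈-map⁻ ι y∈
        ... | s , _ , refl = Coh-sym (K □ (G ⊗ H)) {ι s} (ι-cross s)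
        block-coh keep keep (right c) (here refl) (here refl) = right (left c)

      -- A path begins and ends with an edge of `K`, so unfolding it between two edges of `G` keeps
      -- the alternation.
      expand : Clash exec G → Clash K (G ⊗ H)
      expand c = Refinement.refine Block block-chain block-coh c λ {e} _ → block e
        where
        block : ∀ e → ∃₂ (Block e)
        block (inj₁ _) = _ , _ , unfold
        block (inj₂ _) = _ , _ , keep

    -- `P` stands for membership in the cycle to be compressed. It stays fixed while the recursion
    -- descends into tails of the chain, so all collected edges remain coherent with each other.
    module _ (P : Pred (Edge (K □ (G ⊗ H))) ℓ)
             (P-coh : ∀ {e f} → P e → P f → Coh (K □ (G ⊗ H)) e f) where
      private
        P′ : Pred (Edge (exec □ G)) ℓ
        P′ (inj₁ p) = All (P ∘ ι) (allSteps p)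
        P′ (inj₂ g) = P (inj₂ (inj₁ g))

        P′-coh : ∀ {e f} → P′ e → P′ f → Coh (exec □ G) e f
        P′-coh {inj₁ _} {inj₁ _} ps qs =
          left λ e∈ f∈ → ι-coh⁻ (P-coh (All.lookup ps e∈) (All.lookup qs f∈))
        P′-coh {inj₁ _} {inj₂ _} _ _ = cross
        P′-coh {inj₂ _} {inj₁ _} _ _ = cross′
        P′-coh {inj₂ _} {inj₂ _} p q with P-coh p q
        ... | right (left c) = right c

        module _ {g₀ : Edge G} where

          CompressedFrom : Edge (exec □ G) → Set ℓ
          CompressedFrom e = ∃ λ bs → Chain (Link exec G) e bs (inj₂ g₀) × All P′ bs

          compressG : ∀ {g ys} → Chain (Link K (G ⊗ H)) (inj₂ (inj₁ g)) ys (inj₂ (inj₁ g₀)) →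
                      All P ys → CompressedFrom (inj₂ g)

          -- Reads a path up to its exit into `V`. The calls along the path see only suffixes of it,
          -- while the compressed chain must start at the whole path; hence what follows the exit is
          -- returned as a function of any `p` ending at `v`.
          compressK : ∀ {k ys} → Chain (Link K (G ⊗ H)) (inj₁ k) ys (inj₂ (inj₁ g₀)) → All P ys →
                      ∃₂ λ es v → Path k es v × All (P ∘ ι) es ×
                        (∀ p → to p ≡ v → CompressedFrom (inj₁ p))

          compressG (rl l ∷ c) (Pk ∷ Pys) with compressK c Pys
          ... | es , v , q , Pes , continue =
            let p           = mkPathEdge (sym l) q λ e∈ f∈ →
                                ι-coh⁻ (P-coh (All.lookup (Pk ∷ Pes) e∈) (All.lookup (Pk ∷ Pes) f∈))
                bs , d , Pbs = continue p refl
            in inj₁ p ∷ bs , rl refl ∷ d , (Pk ∷ Pes) ∷ Pbs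

          compressK (last (lr l)) [] =
            [] , _ , stop l , [] , λ _ p≡ → [] , last (lr p≡) , []
          compressK (_∷_ {y = inj₂ (inj₁ g)} (lr l) c) (Pg ∷ Pys) =
            [] , _ , stop l , [] , λ _ p≡ →
              let bs , d , Pbs = compressG c Pys in inj₂ g ∷ bs , lr p≡ ∷ d , Pg ∷ Pbs
          -- The chain ends at an edge of `G`, so an edge of `H` is followed by one of `K` and the
          -- path goes on.
          compressK (_∷_ {y = inj₂ (inj₂ _)} (lr l) (rl l′ ∷ c)) (Ph ∷ Pk ∷ Pys)
            with compressK c Pys
          ... | es , v , q , Pes , continue = _ , v , pass l l′ q , Ph ∷ Pk ∷ Pes , continue

      compress-from : ∀ {g ys} → Chain (Link K (G ⊗ H)) (inj₂ (inj₁ g)) ys (inj₂ (inj₁ g)) →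
                      All P (inj₂ (inj₁ g) ∷ ys) → Clash exec G
      compress-from c (Pg ∷ Pys) with compressG c Pys
      ... | bs , d , Pbs = record
        { chain    = d
        ; coherent = λ e∈ f∈ → P′-coh (All.lookup (Pg ∷ Pbs) e∈) (All.lookup (Pg ∷ Pbs) f∈)
        }

    -- Read from an edge of `G`, the cycle falls into paths separated by edges of `G`.
    compress : (c : Clash K (G ⊗ H)) → ∀ {g} → inj₂ (inj₁ g) ∈ edges c → Clash exec G
    compress c g∈ with rotate-to c g∈
    ... | d , refl = compress-from (_∈ edges d) (coherent d) (chain d) (All.tabulate id)

open Execution using (exec; expand; compress)

-- Replacing a factor of a tensor

module _ {V W : Set ℓ} {K : CoherentGraph (V ⊎ W)} {H : CoherentGraph W} where

  private
    module _ {G : CoherentGraph V} where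

      Avoids : Edge (K □ (G ⊗ H)) → Set ℓ
      Avoids e = ∀ {g} → ¬ e ≡ inj₂ (inj₁ g)

      Meets : Edge (K □ (G ⊗ H)) → Set ℓ
      Meets e = ∃ λ g → e ≡ inj₂ (inj₁ g)

      meets? : ∀ e → Avoids e ⊎ Meets e
      meets? (inj₁ _)        = inj₁ λ ()
      meets? (inj₂ (inj₁ g)) = inj₂ (g , refl)
      meets? (inj₂ (inj₂ _)) = inj₁ λ ()

    -- Defined on the edges of `H` only: a cycle that avoids the left factor survives any change of
    -- it.
    forgetLeft : {G G′ : CoherentGraph V} → PartialMorphism id id (G ⊗ H) (G′ ⊗ H)
    forgetLeft = record
      { _~_      = λ e e′ → ∃ λ h → e ≡ inj₂ h × e′ ≡ inj₂ h
      ; ~-source = λ { (_ , refl , refl) → refl }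
      ; ~-target = λ { (_ , refl , refl) → refl }
      ; ~-Coh    = λ { (_ , refl , refl) (_ , refl , refl) (right c) → right c }
      }

  ⟂-⊗-replaceˡ : {G G′ : CoherentGraph V} → G′ ∈ₚ ｛ G ｝ ^⊥ ^⊥ → K ⟂ G ⊗ H → K ⟂ G′ ⊗ H
  ⟂-⊗-replaceˡ {G} {G′} G′∈ K⟂ = ¬Clash⇒⟂ λ c → avoid-or-meet c (All.decide (meets? {G′}) (edges c))
    where
    exec⟂G : exec K H ⟂ G
    exec⟂G = ¬Clash⇒⟂ (⟂⇒¬Clash K⟂ ∘ expand K H)

    -- The graph `exec K H` is the test to which membership of `G′` in the biorthogonal is applied.
    exec⟂G′ : exec K H ⟂ G′
    exec⟂G′ = ⟂-sym (G′∈ (exec K H) λ { _ refl → exec⟂G })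

    kept : ∀ e → Avoids {G′} e →
           ∃ (Pointwise (_~_ (identity {G = K})) (_~_ (forgetLeft {G′} {G})) e)
    kept (inj₁ k)        _      = inj₁ k , inj₁ refl
    kept (inj₂ (inj₁ _)) avoids = contradiction refl avoids
    kept (inj₂ (inj₂ h)) _      = inj₂ (inj₂ h) , inj₂ (h , refl , refl)

    avoid-or-meet : ∀ c → All (Avoids {G′}) (edges c) ⊎ Any (Meets {G′}) (edges c) → ⊥
    avoid-or-meet c (inj₁ avoids) =
      ⟂⇒¬Clash K⟂ (transport id identity forgetLeft c λ {e} e∈ → kept e (All.lookup avoids e∈))
    avoid-or-meet c (inj₂ meets) with find meets
    ... | _ , g∈ , g , refl = ⟂⇒¬Clash exec⟂G′ (compress K H c g∈)

swap-injective : {A B : Set ℓ} {x y : A ⊎ B} → swap x ≡ swap y → x ≡ y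
swap-injective {x = x} {y} eq =
  trans (sym (swap-involutive x)) (trans (cong swap eq) (swap-involutive y))

⊗-swap : {V W : Set ℓ} (G : CoherentGraph V) (H : CoherentGraph W) →
         PartialMorphism id swap (H ⊗ G) (G ⊗ H)
⊗-swap G H = record
  { _~_      = λ e e′ → swap e ≡ e′
  ; ~-source = λ { {inj₁ _} refl → refl ; {inj₂ _} refl → refl }
  ; ~-target = λ { {inj₁ _} refl → refl ; {inj₂ _} refl → refl }
  ; ~-Coh    = λ { refl refl (left c) → right c ; refl refl (right c) → left c
                 ; refl refl cross → cross′ ; refl refl cross′ → cross }
  }

⟂-swap : {V W : Set ℓ} {K : CoherentGraph (V ⊎ W)} {K′ : CoherentGraph (W ⊎ V)}
         {G : CoherentGraph V} {H : CoherentGraph W} →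
         (M : PartialMorphism id swap K′ K) → (∀ e → ∃ (_~_ M e)) → K ⟂ G ⊗ H → K′ ⟂ H ⊗ G
⟂-swap {G = G} {H} M total K⟂ = ¬Clash⇒⟂ (⟂⇒¬Clash K⟂ ∘
  transport-total swap-injective M (⊗-swap G H) total (λ f → swap f , refl))

-- Exchange the two sides, replace the left factor, and exchange back.
⟂-⊗-replaceʳ : {V W : Set ℓ} {K : CoherentGraph (V ⊎ W)} {G : CoherentGraph V}
               {H H′ : CoherentGraph W} → H′ ∈ₚ ｛ H ｝ ^⊥ ^⊥ → K ⟂ G ⊗ H → K ⟂ G ⊗ H′
⟂-⊗-replaceʳ {K = K} H′∈ K⟂ =
  ⟂-swap back′ (λ e → e , refl) (⟂-⊗-replaceˡ H′∈ (⟂-swap forth (λ e → e , refl) K⟂))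
  where
  forth : PartialMorphism id swap (reindex swap K) K
  forth = record
    { _~_ = _≡_ ; ~-source = λ { refl → refl } ; ~-target = λ { refl → refl }
    ; ~-Coh = λ { refl refl c → c } }

  back′ : PartialMorphism id swap K (reindex swap K)
  back′ = record
    { _~_      = _≡_
    ; ~-source = λ { refl → sym (swap-involutive _) }
    ; ~-target = λ { refl → sym (swap-involutive _) }
    ; ~-Coh    = λ { refl refl c → c }
    }

-- Restrictions of a graph, and tensor against par

restrict : {V U : Set ℓ} → (V → U) → CoherentGraph U → CoherentGraph V
restrict {V = V} i K = record
  { Edge     = ∃ λ k → ∃₂ λ u v → source K k ≡ i u × target K k ≡ i v
  ; source   = λ (_ , u , _) → u
  ; target   = λ (_ , _ , v , _) → v
  ; Coh      = λ (k , _) (k′ , _) → Coh K k k′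
  ; Coh-refl = Coh-refl K
  ; Coh-sym  = Coh-sym K
  }

restriction : {V U : Set ℓ} {i : V → U} {K : CoherentGraph U} →
              PartialMorphism i id (restrict i K) K
restriction = record
  { _~_      = λ (k , _) k′ → k ≡ k′
  ; ~-source = λ { {_ , _ , _ , p , _} refl → sym p }
  ; ~-target = λ { {_ , _ , _ , _ , q} refl → sym q }
  ; ~-Coh    = λ { refl refl c → c }
  }

module _ {V W : Set ℓ} {G : CoherentGraph V} {H : CoherentGraph W} where

  left-⅋ : PartialMorphism inj₁ id G (G ⅋ H)
  left-⅋ = record
    { _~_ = λ e e′ → left e ≡ e′ ; ~-source = λ { refl → refl } ; ~-target = λ { refl → refl }
    ; ~-Coh = λ { refl refl c → left c } }

  right-⅋ : PartialMorphism inj₂ id H (G ⅋ H)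
  right-⅋ = record
    { _~_ = λ e e′ → right e ≡ e′ ; ~-source = λ { refl → refl } ; ~-target = λ { refl → refl }
    ; ~-Coh = λ { refl refl c → right c } }

  -- Partial inverse of `left-⅋`, for cycles that meet `G ⅋ H` in edges of `G` only.
  ⅋-left : PartialMorphism id inj₁ (G ⅋ H) G
  ⅋-left = record
    { _~_ = λ e e′ → e ≡ left e′ ; ~-source = λ { refl → refl } ; ~-target = λ { refl → refl }
    ; ~-Coh = λ { refl refl (left c) → c } }

  ⅋-right : PartialMorphism id inj₂ (G ⅋ H) H
  ⅋-right = record
    { _~_ = λ e e′ → e ≡ right e′ ; ~-source = λ { refl → refl } ; ~-target = λ { refl → refl }
    ; ~-Coh = λ { refl refl (right c) → c } }

  ⊗-left : PartialMorphism id inj₁ (G ⊗ H) G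
  ⊗-left = record
    { _~_ = λ e e′ → e ≡ inj₁ e′ ; ~-source = λ { refl → refl } ; ~-target = λ { refl → refl }
    ; ~-Coh = λ { refl refl (left c) → c } }

  ⊗-right : PartialMorphism id inj₂ (G ⊗ H) H
  ⊗-right = record
    { _~_ = λ e e′ → e ≡ inj₂ e′ ; ~-source = λ { refl → refl } ; ~-target = λ { refl → refl }
    ; ~-Coh = λ { refl refl (right c) → c } }

module _ {V W : Set ℓ} {G G′ : CoherentGraph V} {H H′ : CoherentGraph W} where

  private
    Γ = (G′ ⊗ H′) □ (G ⅋ H)

    InG InH : Edge Γ → Set ℓ
    InG e = ∃ (Pointwise (_~_ (⊗-left {G = G′} {H′})) (_~_ (⅋-left {G = G} {H})) e)
    InH e = ∃ (Pointwise (_~_ (⊗-right {G = G′} {H′})) (_~_ (⅋-right {G = G} {H})) e)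

    -- After an edge of `G` the cycle is in `V`, where the tensor offers only edges of `G′`. The
    -- next edge of `G ⅋ H` is coherent with `g₀`, hence again from `G`.
    all-InG : ∀ {g₀ g es z} → Chain (Link (G′ ⊗ H′) (G ⅋ H)) (inj₂ (left g)) es z →
              All (Coh Γ (inj₂ (left g₀))) es → All InG es
    all-InG (last _) [] = []
    all-InG (_∷_ {y = inj₁ (inj₁ _)} (rl _) (last _)) (_ ∷ []) = (_ , inj₁ refl) ∷ []
    all-InG (_∷_ {y = inj₁ (inj₁ _)} (rl _) (lr _ ∷ c)) (_ ∷ right (left _) ∷ coh) =
      (_ , inj₁ refl) ∷ (_ , inj₂ refl) ∷ all-InG c coh
    all-InG (_∷_ {y = inj₁ (inj₂ _)} (rl ()) _) _

    all-InH : ∀ {h₀ h es z} → Chain (Link (G′ ⊗ H′) (G ⅋ H)) (inj₂ (right h)) es z →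
              All (Coh Γ (inj₂ (right h₀))) es → All InH es
    all-InH (last _) [] = []
    all-InH (_∷_ {y = inj₁ (inj₂ _)} (rl _) (last _)) (_ ∷ []) = (_ , inj₁ refl) ∷ []
    all-InH (_∷_ {y = inj₁ (inj₂ _)} (rl _) (lr _ ∷ c)) (_ ∷ right (right _) ∷ coh) =
      (_ , inj₁ refl) ∷ (_ , inj₂ refl) ∷ all-InH c coh
    all-InH (_∷_ {y = inj₁ (inj₁ _)} (rl ()) _) _

    -- Such a cycle would have to leave u ∈ V for v ∈ W and come back along a
    -- second additional edge, incoherent with the first.
    no-there : ∀ {u v es} → ¬ (Chain (Link (G′ ⊗ H′) (G ⅋ H)) (inj₂ (there u v)) es (inj₂ (there u v))
                               × All (Coh Γ (inj₂ (there u v))) es)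
    no-there (_∷_ {y = inj₁ (inj₁ _)} (rl ()) _ , _)
    no-there (_∷_ {y = inj₁ (inj₂ _)} (rl _) (last (lr ())) , _)
    no-there (_∷_ {y = inj₁ (inj₂ _)} (rl _) (lr () ∷ _) , _ ∷ right there ∷ _)

    no-back : ∀ {u v es} → ¬ (Chain (Link (G′ ⊗ H′) (G ⅋ H)) (inj₂ (back v u)) es (inj₂ (back v u))
                              × All (Coh Γ (inj₂ (back v u))) es)
    no-back (_∷_ {y = inj₁ (inj₂ _)} (rl ()) _ , _)
    no-back (_∷_ {y = inj₁ (inj₁ _)} (rl _) (last (lr ())) , _)
    no-back (_∷_ {y = inj₁ (inj₁ _)} (rl _) (lr () ∷ _) , _ ∷ right back ∷ _)

    -- By alternation, the first or the second edge belongs to `G ⅋ H`.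
    start-⅋ : (c : Clash (G′ ⊗ H′) (G ⅋ H)) →
              Σ (Clash (G′ ⊗ H′) (G ⅋ H)) λ d → ∃ λ e → first d ≡ inj₂ e
    start-⅋ c@record { first = inj₂ e } = c , e , refl
    start-⅋ c@record { first = inj₁ _ ; chain = lr _ ∷ _ } =
      let d , d≡ = rotate-to c (there (here refl)) in d , _ , d≡

  ⊗⟂⅋ : G′ ⟂ G → H′ ⟂ H → G′ ⊗ H′ ⟂ G ⅋ H
  ⊗⟂⅋ G′⟂G H′⟂H = ¬Clash⇒⟂ λ c → let d , e , d≡ = start-⅋ c in refute d e d≡
    where
    coherent-rest : (d : Clash (G′ ⊗ H′) (G ⅋ H)) → All (Coh Γ (first d)) (rest d)
    coherent-rest d = All.tabulate λ e∈ → coherent d (here refl) (there e∈)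

    refute : (d : Clash (G′ ⊗ H′) (G ⅋ H)) → ∀ e → ¬ first d ≡ inj₂ e
    refute d (left g) refl = ⟂⇒¬Clash G′⟂G (transport inj₁-injective ⊗-left ⅋-left d
      (All.lookup ((_ , inj₂ refl) ∷ all-InG (chain d) (coherent-rest d))))
    refute d (right h) refl = ⟂⇒¬Clash H′⟂H (transport inj₂-injective ⊗-right ⅋-right d
      (All.lookup ((_ , inj₂ refl) ∷ all-InH (chain d) (coherent-rest d))))
    refute d (there _ _) refl = no-there (chain d , coherent-rest d)
    refute d (back _ _)  refl = no-back (chain d , coherent-rest d)

module _ {V W : Set ℓ} {G : CoherentGraph V} {H : CoherentGraph W} {K : CoherentGraph (V ⊎ W)}
         (K⟂ : K ⟂ G ⅋ H) where

  -- The inclusions into `K` and `G ⅋ H` preserve coherence, so they carry clashes along.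
  restrict-⟂ˡ : restrict inj₁ K ⟂ G
  restrict-⟂ˡ = ¬Clash⇒⟂ (⟂⇒¬Clash K⟂ ∘
    transport-total id restriction left-⅋ (λ e → _ , refl) (λ g → _ , refl))

  restrict-⟂ʳ : restrict inj₂ K ⟂ H
  restrict-⟂ʳ = ¬Clash⇒⟂ (⟂⇒¬Clash K⟂ ∘
    transport-total id restriction right-⅋ (λ e → _ , refl) (λ h → _ , refl))

  private
    clash₂ : ∀ {k e} → target K k ≡ source (G ⅋ H) e → target (G ⅋ H) e ≡ source K k → Clash K (G ⅋ H)
    clash₂ {k} {e} p q = record
      { first    = inj₁ k
      ; rest     = inj₂ e ∷ []
      ; chain    = lr p ∷ last (rl q)
      ; coherent = λ
        { (here refl)         (here refl)         → left (Coh-refl K)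
        ; (here refl)         (there (here refl)) → cross
        ; (there (here refl)) (here refl)         → cross′
        ; (there (here refl)) (there (here refl)) → right (Coh-refl (G ⅋ H))
        }
      }

  data Component : Edge K → Edge (restrict inj₁ K ⊗ restrict inj₂ K) → Set ℓ where
    inV : ∀ {k u v p q} → Component k (inj₁ (k , u , v , p , q))
    inW : ∀ {k u v p q} → Component k (inj₂ (k , u , v , p , q))

  -- The tensor makes edges of different components coherent even where `K` does not, so clashes are
  -- carried out of `K` only.
  component : PartialMorphism id id K (restrict inj₁ K ⊗ restrict inj₂ K)
  component = record
    { _~_      = Component
    ; ~-source = λ { (inV {p = p}) → p ; (inW {p = p}) → p }
    ; ~-target = λ { (inV {q = q}) → q ; (inW {q = q}) → q }
    ; ~-Coh    = λ { inV inV c → left c ; inV inW _ → cross ; inW inV _ → cross′ ; inW inW c → right c }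
    }

  -- An edge of K between V and W would close a cycle of length 2 with the
  -- opposite additional edge of G ⅋ H.
  component-total : ∀ k → ∃ (Component k)
  component-total k with source K k in p | target K k in q
  ... | inj₁ _ | inj₁ _ = _ , inV {p = p} {q}
  ... | inj₂ _ | inj₂ _ = _ , inW {p = p} {q}
  ... | inj₁ u | inj₂ v = contradiction (clash₂ {e = back v u} q (sym p)) (⟂⇒¬Clash K⟂)
  ... | inj₂ v | inj₁ u = contradiction (clash₂ {e = there u v} q (sym p)) (⟂⇒¬Clash K⟂)

  ⟂-from-components : {L : CoherentGraph (V ⊎ W)} →
                      restrict inj₁ K ⊗ restrict inj₂ K ⟂ L → K ⟂ L
  ⟂-from-components K′⟂L = ¬Clash⇒⟂ (⟂⇒¬Clash K′⟂L ∘
    transport-total id component identity component-total (λ e → e , refl))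

-- The two equations

proposition37 : {ℓ : Level} {V W : Set ℓ} (G : CoherentGraph V) (H : CoherentGraph W) →
    ((｛ G ｝ ^⊥ᶜ ⅋ᶜ ｛ H ｝ ^⊥ᶜ) ≐ᶜ ｛ G ⊗ H ｝ ^⊥ᶜ) ×
    ((｛ G ｝ ^⊥ᶜ ⊗ᶜ ｛ H ｝ ^⊥ᶜ) ≐ᶜ ｛ G ⅋ H ｝ ^⊥ᶜ)
proposition37 G H =
  -- `G` and `H` lie in their own biorthogonals, so `G ⊗ H` is one of the tensors tested.
  ( (λ { K∈ _ refl → K∈ (G ⊗ H) (⊆-^⊥^⊥ _ (tensor (⊆-^⊥^⊥ _ refl) (⊆-^⊥^⊥ _ refl))) })
  -- The orthogonal of the tensors embeds in its own biorthogonal, so testing actual tensors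
  -- `G′ ⊗ H′` is enough.
  , λ K∈ → ⊆-^⊥^⊥ _ (λ { _ (tensor G′∈ H′∈) →
      ⟂-⊗-replaceʳ H′∈ (⟂-⊗-replaceˡ G′∈ (K∈ (G ⊗ H) refl)) })
  ) ,
  -- It suffices that `G ⅋ H` is orthogonal to every tensor.
  ( ^⊥-antitone (λ { refl L (tensor G′∈ H′∈) → ⟂-sym (⊗⟂⅋ (G′∈ G refl) (H′∈ H refl)) })
  -- `L` is orthogonal to all tensors, in particular to that of the two restrictions of `K`.
  , λ K∈ L L∈ → let K⟂ = K∈ (G ⅋ H) refl in
      ⟂-from-components K⟂ (⟂-sym (L∈ _ (tensor (λ { _ refl → restrict-⟂ˡ K⟂ })
                                                (λ { _ refl → restrict-⟂ʳ K⟂ }))))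
  )
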